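{- Let $A(n)$ be an arbitrary formula of $\mathrm{HA}^\omega$ and let $R$ be a $\Sigma^0_1$-formula. Then, provably in $\mathrm{HA}^\omega+\mathrm{BI}+\mathrm{CONT}$ together with the defining equation of $\mathsf{ips}$, the functional $\mathsf{ips}_0$ modified realizes the $J$-shift $$\forall n^{\mathbb{N}}\,J_RA(n)\;\to\;J_R\,\forall n\,A(n),\qquad\text{where } J_RB:=(B\to R)\to B.$$ That is, whenever $\varepsilon_n$ modified realizes $(A(n)\to R)\to A(n)$ for all $n$, and $q$ modified realizes $\forall nA(n)\to R$, the sequence $\mathsf{ips}_0(\varepsilon)(q)$ modified realizes $\forall nA(n)$.
   Context: $\mathrm{HA}^\omega$ is Heyting arithmetic in all finite types with fully extensional equality (Troelstra's E-$\mathrm{HA}^\omega$); finite types are generated from $\mathbb{B}$ and $\mathbb{N}$ by products, function types and finite sequence types. "$t$ modified realizes $A$" is Kreisel's modified realizability (Troelstra 1973): in particular $f$ realizes $B\to C$ iff $f(x)$ realizes $C$ for every $x$ realizing $B$, and $f$ realizes $\forall nB(n)$ iff $f(n)$ realizes $B(n)$ for all $n$. $R$ denotes both the formula and the type of its realizers (a discrete type); $X_n$ denotes the type of realizers of $A(n)$ (which does not in fact depend on $n$), and $\Pi_iX_{i}$ the type of infinite sequences with $i$-th entry in $X_i$. $\mathsf{ips}$ (implicitly controlled product of selection functions). With $J_RX=(X\to R)\to X$ for types, $\varepsilon\colon\Pi_kJ_RX_k$ and $q\colon\Pi_iX_{i+n}\to R$, the value $\mathsf{ips}_n(\varepsilon)(q)\colon\Pi_iX_{i+n}$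 is specified by $$\mathsf{ips}_n(\varepsilon)(q)=c*\mathsf{ips}_{n+1}(\varepsilon)(q_c),\qquad c=\varepsilon_n(\lambda x.\,q_x(\mathsf{ips}_{n+1}(\varepsilon)(q_x))),$$ where $*$ is concatenation and $q_x(\alpha)=q(x*\alpha)$. $[\alpha](n)=\langle\alpha(0),\dots,\alpha(n-1)\rangle$. $\mathrm{CONT}$: for discrete $R$, $\forall q^{\Pi_iX_i\to R}\,\forall\alpha\,\exists n\,\forall\beta\,([\alpha](n)=[\beta](n)\to q(\alpha)=q(\beta))$. Discrete and compact types are generated by: compact $::=\mathbb{B}\mid$ compact $\times$ compact $\mid$ discrete $\to$ compact; discrete $::=\mathbb{B}\mid\mathbb{N}\mid$ discrete $\times$ discrete $\mid$ discrete$^*$ $\mid$ compact $\to$ discrete. $\mathrm{BI}$ (relativised bar induction) is the scheme, for arbitrary predicates $S,P$ on finite sequences: if $S(\langle\rangle)$, and for every infinite $\alpha$ with $S([\alpha](n))$ for all $n$ there is $n$ with $P([\alpha](n))$, and for all $s$ with $S(s)$: $\forall x[S(s*x)\to P(s*x)]\to P(s)$; then $P(\langle\rangle)$. -}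

module Defs where

open import Data.List using (List; []; _∷_; map)
open import Data.List.Membership.Propositional using (_∈_)
open import Data.List.Relation.Unary.Any using (here; there)
open import Data.Product using (∃; _,_; -,_)
open import Relation.Binary.PropositionalEquality using (refl)

infixr 6 _⇒_
infixr 7 _⊗_
infix  8 _⋆

data Ty : Set where
  bool nat : Ty
  _⊗_ _⇒_  : Ty → Ty → Ty
  _⋆       : Ty → Ty          -- finite sequences

mutual
  data Compact : Ty → Set where
    bool : Compact bool
    _⊗_  : ∀ {σ τ} → Compact σ → Compact τ → Compact (σ ⊗ τ)
    _⇒_  : ∀ {σ τ} → Discrete σ → Compact τ → Compact (σ ⇒ τ)

  data Discrete : Ty → Set where
    bool : Discrete bool
    nat  : Discrete nat
    _⊗_  : ∀ {σ τ} → Discrete σ → Discrete τ → Discrete (σ ⊗ τ)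
    _⋆   : ∀ {σ} → Discrete σ → Discrete (σ ⋆)
    _⇒_  : ∀ {σ τ} → Compact σ → Discrete τ → Discrete (σ ⇒ τ)

Ctx : Set
Ctx = List Ty

-- Finite sequences grow at the end: `snoc s x` is s * x, and `fold` is
-- primitive recursion along that structure.
data Con : Ty → Set where
  tt ff : Con bool
  if    : ∀ {σ} → Con (bool ⇒ σ ⇒ σ ⇒ σ)
  zero  : Con nat
  suc   : Con (nat ⇒ nat)
  rec   : ∀ {σ} → Con (σ ⇒ (nat ⇒ σ ⇒ σ) ⇒ nat ⇒ σ)
  pair  : ∀ {σ τ} → Con (σ ⇒ τ ⇒ σ ⊗ τ)
  fst   : ∀ {σ τ} → Con (σ ⊗ τ ⇒ σ)
  snd   : ∀ {σ τ} → Con (σ ⊗ τ ⇒ τ)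
  nil   : ∀ {σ} → Con (σ ⋆)
  snoc  : ∀ {σ} → Con (σ ⋆ ⇒ σ ⇒ σ ⋆)
  fold  : ∀ {σ τ} → Con (τ ⇒ (σ ⋆ ⇒ σ ⇒ τ ⇒ τ) ⇒ σ ⋆ ⇒ τ)

infixl 9 _·_

data Tm (Γ : Ctx) : Ty → Set where
  var : ∀ {σ} → σ ∈ Γ → Tm Γ σ
  con : ∀ {σ} → Con σ → Tm Γ σ
  ƛ   : ∀ {σ τ} → Tm (σ ∷ Γ) τ → Tm Γ (σ ⇒ τ)
  _·_ : ∀ {σ τ} → Tm Γ (σ ⇒ τ) → Tm Γ σ → Tm Γ τ

v0 : ∀ {Γ σ} → Tm (σ ∷ Γ) σ
v0 = var (here refl)

v1 : ∀ {Γ σ τ} → Tm (τ ∷ σ ∷ Γ) σ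
v1 = var (there (here refl))

v2 : ∀ {Γ σ τ υ} → Tm (υ ∷ τ ∷ σ ∷ Γ) σ
v2 = var (there (there (here refl)))

Ren Sub : Ctx → Ctx → Set
Ren Γ Δ = ∀ {σ} → σ ∈ Γ → σ ∈ Δ
Sub Γ Δ = ∀ {σ} → σ ∈ Γ → Tm Δ σ

liftR : ∀ {Γ Δ σ} → Ren Γ Δ → Ren (σ ∷ Γ) (σ ∷ Δ)
liftR ρ (here p)  = here p
liftR ρ (there x) = there (ρ x)

renT : ∀ {Γ Δ σ} → Ren Γ Δ → Tm Γ σ → Tm Δ σ
renT ρ (var x) = var (ρ x)
renT ρ (con k) = con k
renT ρ (ƛ t)   = ƛ (renT (liftR ρ) t)
renT ρ (t · u) = renT ρ t · renT ρ u

infix 10 _↑ _⇑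

_↑ : ∀ {Γ σ τ} → Tm Γ σ → Tm (τ ∷ Γ) σ
t ↑ = renT there t

liftS : ∀ {Γ Δ σ} → Sub Γ Δ → Sub (σ ∷ Γ) (σ ∷ Δ)
liftS θ (here p)  = var (here p)
liftS θ (there x) = θ x ↑

subT : ∀ {Γ Δ σ} → Sub Γ Δ → Tm Γ σ → Tm Δ σ
subT θ (var x) = θ x
subT θ (con k) = con k
subT θ (ƛ t)   = ƛ (subT (liftS θ) t)
subT θ (t · u) = subT θ t · subT θ u

infixl 5 _▸_

_▸_ : ∀ {Γ Δ σ} → Sub Γ Δ → Tm Δ σ → Sub (σ ∷ Γ) Δ
(θ ▸ t) (here refl) = t
(θ ▸ t) (there x)   = θ x

w0 : ∀ {Γ} → Sub Γ Γ
w0 = var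

w1 : ∀ {Γ σ} → Sub Γ (σ ∷ Γ)
w1 x = var (there x)

w2 : ∀ {Γ σ τ} → Sub Γ (τ ∷ σ ∷ Γ)
w2 x = var (there (there x))

-- Formulas.  A formula is indexed by its shape, which forgets the terms
-- in it.  The type of realizers depends on the shape alone and is hence
-- definitionally invariant under substitution.

infixr 4 _imp_
infixr 5 _or_
infixr 6 _and_

data Shape : Set where
  eq            : Ty → Shape
  bot           : Shape
  _and_ _or_ _imp_ : Shape → Shape → Shape
  all ex        : Ty → Shape → Shape

infix  7 _≐_
infixr 6 _∧̇_
infixr 5 _∨̇_
infixr 4 _⊃_

data Fm (Γ : Ctx) : Shape → Set where
  _≐_ : ∀ {σ} → Tm Γ σ → Tm Γ σ → Fm Γ (eq σ)
  ⊥̇   : Fm Γ bot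
  _∧̇_ : ∀ {a b} → Fm Γ a → Fm Γ b → Fm Γ (a and b)
  _∨̇_ : ∀ {a b} → Fm Γ a → Fm Γ b → Fm Γ (a or b)
  _⊃_ : ∀ {a b} → Fm Γ a → Fm Γ b → Fm Γ (a imp b)
  ∀̇   : ∀ {σ a} → Fm (σ ∷ Γ) a → Fm Γ (all σ a)
  ∃̇   : ∀ {σ a} → Fm (σ ∷ Γ) a → Fm Γ (ex σ a)

renF : ∀ {Γ Δ a} → Ren Γ Δ → Fm Γ a → Fm Δ a
renF ρ (t ≐ u) = renT ρ t ≐ renT ρ u
renF ρ ⊥̇       = ⊥̇
renF ρ (A ∧̇ B) = renF ρ A ∧̇ renF ρ B
renF ρ (A ∨̇ B) = renF ρ A ∨̇ renF ρ B
renF ρ (A ⊃ B) = renF ρ A ⊃ renF ρ B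
renF ρ (∀̇ A)   = ∀̇ (renF (liftR ρ) A)
renF ρ (∃̇ A)   = ∃̇ (renF (liftR ρ) A)

_⇑ : ∀ {Γ σ a} → Fm Γ a → Fm (σ ∷ Γ) a
A ⇑ = renF there A

subF : ∀ {Γ Δ a} → Sub Γ Δ → Fm Γ a → Fm Δ a
subF θ (t ≐ u) = subT θ t ≐ subT θ u
subF θ ⊥̇       = ⊥̇
subF θ (A ∧̇ B) = subF θ A ∧̇ subF θ B
subF θ (A ∨̇ B) = subF θ A ∨̇ subF θ B
subF θ (A ⊃ B) = subF θ A ⊃ subF θ B
subF θ (∀̇ A)   = ∀̇ (subF (liftS θ) A)
subF θ (∃̇ A)   = ∃̇ (subF (liftS θ) A)

infix 10 _[_]

_[_] : ∀ {Γ σ a} → Fm (σ ∷ Γ) a → Tm Γ σ → Fm Γ a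
A [ t ] = subF (w0 ▸ t) A

-- Equations are quantifier-free only at the base types: in E-HA^ω an
-- equation between functions amounts to a universal statement.
data QuantifierFree : Shape → Set where
  eq-bool : QuantifierFree (eq bool)
  eq-nat  : QuantifierFree (eq nat)
  bot     : QuantifierFree bot
  _and_   : ∀ {a b} → QuantifierFree a → QuantifierFree b → QuantifierFree (a and b)
  _or_    : ∀ {a b} → QuantifierFree a → QuantifierFree b → QuantifierFree (a or b)
  _imp_   : ∀ {a b} → QuantifierFree a → QuantifierFree b → QuantifierFree (a imp b)

data Σ⁰₁ : Shape → Set where
  ex-nat : ∀ {a} → QuantifierFree a → Σ⁰₁ (ex nat a)

-- cons x α is x * α, by recursion: (x * α)(0) = x and (x * α)(k+1) = α(k).
cons : ∀ {Γ σ} → Tm Γ σ → Tm Γ (nat ⇒ σ) → Tm Γ (nat ⇒ σ)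
cons x α = ƛ (con rec · x ↑ · ƛ (ƛ (α ↑ ↑ ↑ · v1)) · v0)

-- [α](n), by recursion: [α](0) = ⟨⟩ and [α](n+1) = [α](n) * α(n).
init : ∀ {Γ σ} → Tm Γ (nat ⇒ σ) → Tm Γ nat → Tm Γ (σ ⋆)
init α n = con rec · con nil · ƛ (ƛ (con snoc · v0 · (α ↑ ↑ · v1))) · n

CONT : ∀ {Γ} (σ ρ : Ty) → Fm Γ _
CONT σ ρ =
  ∀̇ {σ = (nat ⇒ σ) ⇒ ρ} (∀̇ {σ = nat ⇒ σ} (∃̇ {σ = nat} (∀̇ {σ = nat ⇒ σ}
    (init v2 v1 ≐ init v0 v1 ⊃ q · v2 ≐ q · v0))))
  where q = var (there (there (there (here refl))))

BI : ∀ {Γ σ s p} → Fm (σ ⋆ ∷ Γ) s → Fm (σ ⋆ ∷ Γ) p → Fm Γ _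
BI {σ = σ} S P =
    S [ con nil ]
  ⊃ ∀̇ {σ = nat ⇒ σ}
      (  ∀̇ {σ = nat} (subF (w2 ▸ init v1 v0) S)
       ⊃ ∃̇ {σ = nat} (subF (w2 ▸ init v1 v0) P))
  ⊃ ∀̇ {σ = σ ⋆}
      (  S
       ⊃ ∀̇ {σ = σ} (  subF (w2 ▸ con snoc · v1 · v0) S
                    ⊃ subF (w2 ▸ con snoc · v1 · v0) P)
       ⊃ P)
  ⊃ P [ con nil ]

-- E-HA^ω + BI + CONT.  Equality is primitive at every type, with
-- replacement and function extensionality.

Hyps : Ctx → Set
Hyps Γ = List (∃ (Fm Γ))

wkHyps : ∀ {Γ σ} → Hyps Γ → Hyps (σ ∷ Γ)
wkHyps = map (λ (_ , A) → -, A ⇑)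

infix 2 _⊢_

data _⊢_ {Γ : Ctx} (Δ : Hyps Γ) : ∀ {a} → Fm Γ a → Set where
  hyp  : ∀ {a} {A : Fm Γ a} → (a , A) ∈ Δ → Δ ⊢ A
  ⊥E   : ∀ {a} {A : Fm Γ a} → Δ ⊢ ⊥̇ → Δ ⊢ A
  ∧I   : ∀ {a b} {A : Fm Γ a} {B : Fm Γ b} → Δ ⊢ A → Δ ⊢ B → Δ ⊢ A ∧̇ B
  ∧E₁  : ∀ {a b} {A : Fm Γ a} {B : Fm Γ b} → Δ ⊢ A ∧̇ B → Δ ⊢ A
  ∧E₂  : ∀ {a b} {A : Fm Γ a} {B : Fm Γ b} → Δ ⊢ A ∧̇ B → Δ ⊢ B
  ∨I₁  : ∀ {a b} {A : Fm Γ a} {B : Fm Γ b} → Δ ⊢ A → Δ ⊢ A ∨̇ B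
  ∨I₂  : ∀ {a b} {A : Fm Γ a} {B : Fm Γ b} → Δ ⊢ B → Δ ⊢ A ∨̇ B
  ∨E   : ∀ {a b c} {A : Fm Γ a} {B : Fm Γ b} {C : Fm Γ c} →
         Δ ⊢ A ∨̇ B → (a , A) ∷ Δ ⊢ C → (b , B) ∷ Δ ⊢ C → Δ ⊢ C
  ⊃I   : ∀ {a b} {A : Fm Γ a} {B : Fm Γ b} → (a , A) ∷ Δ ⊢ B → Δ ⊢ A ⊃ B
  ⊃E   : ∀ {a b} {A : Fm Γ a} {B : Fm Γ b} → Δ ⊢ A ⊃ B → Δ ⊢ A → Δ ⊢ B
  ∀I   : ∀ {σ a} {A : Fm (σ ∷ Γ) a} → wkHyps Δ ⊢ A → Δ ⊢ ∀̇ A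
  ∀E   : ∀ {σ a} {A : Fm (σ ∷ Γ) a} → Δ ⊢ ∀̇ A → (t : Tm Γ σ) → Δ ⊢ A [ t ]
  ∃I   : ∀ {σ a} {A : Fm (σ ∷ Γ) a} (t : Tm Γ σ) → Δ ⊢ A [ t ] → Δ ⊢ ∃̇ A
  ∃E   : ∀ {σ a c} {A : Fm (σ ∷ Γ) a} {C : Fm Γ c} →
         Δ ⊢ ∃̇ A → (a , A) ∷ wkHyps Δ ⊢ C ⇑ → Δ ⊢ C

  ≐-refl : ∀ {σ} {t : Tm Γ σ} → Δ ⊢ t ≐ t
  ≐-subst : ∀ {σ a} (A : Fm (σ ∷ Γ) a) {t u : Tm Γ σ} →
            Δ ⊢ t ≐ u → Δ ⊢ A [ t ] → Δ ⊢ A [ u ]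
  ≐-ext  : ∀ {σ τ} {f g : Tm Γ (σ ⇒ τ)} →
           Δ ⊢ ∀̇ (f ↑ · v0 ≐ g ↑ · v0) → Δ ⊢ f ≐ g

  β      : ∀ {σ τ} (t : Tm (σ ∷ Γ) τ) (u : Tm Γ σ) →
           Δ ⊢ ƛ t · u ≐ subT (w0 ▸ u) t
  if-tt  : ∀ {σ} (t u : Tm Γ σ) → Δ ⊢ con if · con tt · t · u ≐ t
  if-ff  : ∀ {σ} (t u : Tm Γ σ) → Δ ⊢ con if · con ff · t · u ≐ u
  rec-zero : ∀ {σ} (t : Tm Γ σ) (f : Tm Γ (nat ⇒ σ ⇒ σ)) →
             Δ ⊢ con rec · t · f · con zero ≐ t
  rec-suc  : ∀ {σ} (t : Tm Γ σ) (f : Tm Γ (nat ⇒ σ ⇒ σ)) (n : Tm Γ nat) →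
             Δ ⊢ con rec · t · f · (con suc · n) ≐ f · n · (con rec · t · f · n)
  fst-pair : ∀ {σ τ} (t : Tm Γ σ) (u : Tm Γ τ) →
             Δ ⊢ con fst · (con pair · t · u) ≐ t
  snd-pair : ∀ {σ τ} (t : Tm Γ σ) (u : Tm Γ τ) →
             Δ ⊢ con snd · (con pair · t · u) ≐ u
  pair-η   : ∀ {σ τ} (p : Tm Γ (σ ⊗ τ)) →
             Δ ⊢ con pair · (con fst · p) · (con snd · p) ≐ p
  fold-nil  : ∀ {σ τ} (t : Tm Γ τ) (f : Tm Γ (σ ⋆ ⇒ σ ⇒ τ ⇒ τ)) →
              Δ ⊢ con fold · t · f · con nil ≐ t
  fold-snoc : ∀ {σ τ} (t : Tm Γ τ) (f : Tm Γ (σ ⋆ ⇒ σ ⇒ τ ⇒ τ))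
              (s : Tm Γ (σ ⋆)) (x : Tm Γ σ) →
              Δ ⊢ con fold · t · f · (con snoc · s · x)
                    ≐ f · s · x · (con fold · t · f · s)

  tt≠ff    : Δ ⊢ con tt ≐ con ff → Δ ⊢ ⊥̇
  zero≠suc : {n : Tm Γ nat} → Δ ⊢ con zero ≐ con suc · n → Δ ⊢ ⊥̇
  suc-inj  : {m n : Tm Γ nat} → Δ ⊢ con suc · m ≐ con suc · n → Δ ⊢ m ≐ n

  bool-ind : ∀ {a} (A : Fm (bool ∷ Γ) a) →
             Δ ⊢ A [ con tt ] → Δ ⊢ A [ con ff ] → Δ ⊢ ∀̇ A
  nat-ind  : ∀ {a} (A : Fm (nat ∷ Γ) a) →
             Δ ⊢ A [ con zero ] →
             Δ ⊢ ∀̇ (A ⊃ subF (w1 ▸ con suc · v0) A) →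
             Δ ⊢ ∀̇ A
  seq-ind  : ∀ {σ a} (A : Fm (σ ⋆ ∷ Γ) a) →
             Δ ⊢ A [ con nil ] →
             Δ ⊢ ∀̇ (A ⊃ ∀̇ (subF (w2 ▸ con snoc · v1 · v0) A)) →
             Δ ⊢ ∀̇ A

  bi   : ∀ {σ s p} (S : Fm (σ ⋆ ∷ Γ) s) (P : Fm (σ ⋆ ∷ Γ) p) → Δ ⊢ BI S P
  cont : ∀ {σ ρ} → Discrete ρ → Δ ⊢ CONT σ ρ

-- Every formula has a single type of realizers;
-- where there is nothing to realize, an unused boolean stands in for the
-- empty tuple.

tp : Shape → Ty
tp (eq _)    = bool
tp bot       = bool
tp (a and b) = tp a ⊗ tp b
tp (a or b)  = bool ⊗ tp a ⊗ tp b
tp (a imp b) = tp a ⇒ tp b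
tp (all σ a) = σ ⇒ tp a
tp (ex σ a)  = σ ⊗ tp a

mrShape : Shape → Shape
mrShape (eq σ)    = eq σ
mrShape bot       = bot
mrShape (a and b) = mrShape a and mrShape b
mrShape (a or b)  = (eq bool imp mrShape a) and (eq bool imp mrShape b)
mrShape (a imp b) = all (tp a) (mrShape a imp mrShape b)
mrShape (all σ a) = all σ (mrShape a)
mrShape (ex σ a)  = mrShape a

infix 3 _mr_

_mr_ : ∀ {Γ a} → Tm Γ (tp a) → Fm Γ a → Fm Γ (mrShape a)
_mr_ {a = eq _}    t (r ≐ s) = r ≐ s
_mr_ {a = bot}     t ⊥̇       = ⊥̇
_mr_ {a = a and b} t (A ∧̇ B) = (con fst · t mr A) ∧̇ (con snd · t mr B)
_mr_ {a = a or b}  t (A ∨̇ B) =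
    (con fst · t ≐ con tt ⊃ (con fst · (con snd · t) mr A))
  ∧̇ (con fst · t ≐ con ff ⊃ (con snd · (con snd · t) mr B))
_mr_ {a = a imp b} t (A ⊃ B) = ∀̇ ((v0 mr A ⇑) ⊃ (t ↑ · v0 mr B ⇑))
_mr_ {a = all _ a} t (∀̇ A)   = ∀̇ (t ↑ · v0 mr A)
_mr_ {a = ex _ a}  t (∃̇ A)   = con snd · t mr A [ con fst · t ]

J : ∀ {Γ a r} → Fm Γ r → Fm Γ a → Fm Γ ((a imp r) imp a)
J R B = (B ⊃ R) ⊃ B

J-shift : ∀ {Γ a r} → Fm (nat ∷ Γ) a → Fm Γ r → Fm Γ _
J-shift A R = ∀̇ (J (R ⇑) A) ⊃ J R (∀̇ A)

Jᵗ : Ty → Ty → Ty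
Jᵗ ρ σ = (σ ⇒ ρ) ⇒ σ

ipsTy : Ty → Ty → Ty
ipsTy σ ρ = nat ⇒ (nat ⇒ Jᵗ ρ σ) ⇒ Jᵗ ρ (nat ⇒ σ)

-- after q x is the functional q_x.
after : ∀ {Γ σ ρ} → Tm Γ ((nat ⇒ σ) ⇒ ρ) → Tm Γ σ → Tm Γ ((nat ⇒ σ) ⇒ ρ)
after q x = ƛ (q ↑ · cons (x ↑) v0)

-- The defining equation of ips.  A variable ips under this hypothesis plays
-- the role of a new constant with this equation as its axiom, so that the
-- language of formulas stays that of HA^ω.
ipsEq : ∀ {Γ σ ρ} → Tm Γ (ipsTy σ ρ) → Fm Γ _
ipsEq {Γ} {σ} {ρ} ips =
  ∀̇ {σ = nat} (∀̇ {σ = nat ⇒ Jᵗ ρ σ} (∀̇ {σ = (nat ⇒ σ) ⇒ ρ}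
    (ips ↑ ↑ ↑ · n · ε · q ≐ cons c (next · after q c))))
  where
  n : Tm (((nat ⇒ σ) ⇒ ρ) ∷ (nat ⇒ Jᵗ ρ σ) ∷ nat ∷ Γ) nat
  n = v2
  ε : Tm (((nat ⇒ σ) ⇒ ρ) ∷ (nat ⇒ Jᵗ ρ σ) ∷ nat ∷ Γ) (nat ⇒ Jᵗ ρ σ)
  ε = v1
  q : Tm (((nat ⇒ σ) ⇒ ρ) ∷ (nat ⇒ Jᵗ ρ σ) ∷ nat ∷ Γ) ((nat ⇒ σ) ⇒ ρ)
  q = v0
  next : Tm (((nat ⇒ σ) ⇒ ρ) ∷ (nat ⇒ Jᵗ ρ σ) ∷ nat ∷ Γ) (Jᵗ ρ (nat ⇒ σ))
  next = ips ↑ ↑ ↑ · (con suc · n) · ε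
  c : Tm (((nat ⇒ σ) ⇒ ρ) ∷ (nat ⇒ Jᵗ ρ σ) ∷ nat ∷ Γ) σ
  c = ε · n · ƛ (after (q ↑) v0 · (next ↑ · after (q ↑) v0))

{-# OPTIONS --safe #-}
module Submission where

-- Write |s| for the length of s and q_s for λα. q(s * α).  Relativised bar
-- induction is applied to P(s), saying that ips_|s|(ε)(q_s)(i) realizes
-- A(|s| + i) for all i, along the s whose entries realize A and for which q_s
-- realizes ∀i A(|s| + i) → R.
-- Step: if x realizes A(|s|), then P(s * x) makes q(s * x * ips(ε)(q_{s*x}))
-- realize R, so the argument of ε_|s| realizes A(|s|) → R, the head c
-- realizes A(|s|), and P(s * c) yields the tail.
-- Bar: if all α(n) realize A(n), then q(α) realizes R, and by CONT q_{[α](n)}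
-- is constant with value q(α) for some n.  So is every further q_{[α](n)*t},
-- whence each ε_m is applied to the constant function with value q(α), which
-- realizes A(m) → R.

open import Data.Fin using (#_)
open import Data.List using (List; []; _∷_; _++_; length; lookup; map)
open import Data.List.Membership.Propositional using (_∈_)
open import Data.List.Membership.Propositional.Properties using (∈-lookup; ∈-map⁺)
open import Data.List.Relation.Unary.Any using (here; there)
open import Data.Maybe using (Maybe; just; nothing)
open import Data.Nat using (ℕ; zero; suc; _<?_)
open import Data.Product using (Σ; ∃; _×_; _,_; -,_; proj₁; proj₂)
open import Function using (_∘_)
open import Relation.Binary.PropositionalEquality
  using (_≡_; refl; sym; trans; cong; cong₂; subst)
open import Relation.Nullary.Decidable using (True)
open import Defs

-- Substitution

module _ where
  private variable
    Γ Δ Ξ : Ctx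
    σ τ : Ty
    a : Shape

  -- Here and below the composite is described pointwise: lifting under a binder preserves such
  -- agreement without function extensionality.
  ren-ren : {ρ : Ren Γ Δ} {ρ′ : Ren Δ Ξ} {ρ″ : Ren Γ Ξ} →
            (∀ {σ} (x : σ ∈ Γ) → ρ′ (ρ x) ≡ ρ″ x) →
            (t : Tm Γ τ) → renT ρ′ (renT ρ t) ≡ renT ρ″ t
  ren-ren h (var x) = cong var (h x)
  ren-ren h (con k) = refl
  ren-ren h (ƛ t)   = cong ƛ (ren-ren (λ { (here p) → refl ; (there x) → cong there (h x) }) t)
  ren-ren h (t · u) = cong₂ _·_ (ren-ren h t) (ren-ren h u)

  ↑-ren : {ρ : Ren Γ Δ} (t : Tm Γ τ) → renT (liftR {σ = σ} ρ) (t ↑) ≡ renT ρ t ↑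
  ↑-ren t = trans (ren-ren (λ _ → refl) t) (sym (ren-ren (λ _ → refl) t))

  sub-ren : {ρ : Ren Γ Δ} {θ : Sub Δ Ξ} {θ′ : Sub Γ Ξ} →
            (∀ {σ} (x : σ ∈ Γ) → θ (ρ x) ≡ θ′ x) →
            (t : Tm Γ τ) → subT θ (renT ρ t) ≡ subT θ′ t
  sub-ren h (var x) = h x
  sub-ren h (con k) = refl
  sub-ren h (ƛ t)   = cong ƛ (sub-ren (λ { (here p) → refl ; (there x) → cong _↑ (h x) }) t)
  sub-ren h (t · u) = cong₂ _·_ (sub-ren h t) (sub-ren h u)

  ren-sub : {θ : Sub Γ Δ} {ρ : Ren Δ Ξ} {θ′ : Sub Γ Ξ} →
            (∀ {σ} (x : σ ∈ Γ) → renT ρ (θ x) ≡ θ′ x) →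
            (t : Tm Γ τ) → renT ρ (subT θ t) ≡ subT θ′ t
  ren-sub h (var x) = h x
  ren-sub h (con k) = refl
  ren-sub {θ = θ} h (ƛ t) =
    cong ƛ (ren-sub (λ { (here p) → refl ; (there x) → trans (↑-ren (θ x)) (cong _↑ (h x)) }) t)
  ren-sub h (t · u) = cong₂ _·_ (ren-sub h t) (ren-sub h u)

  ↑-sub : {θ : Sub Γ Δ} (t : Tm Γ τ) → subT (liftS {σ = σ} θ) (t ↑) ≡ subT θ t ↑
  ↑-sub t = trans (sub-ren (λ _ → refl) t) (sym (ren-sub (λ _ → refl) t))

  sub-sub : {θ : Sub Γ Δ} {θ′ : Sub Δ Ξ} {θ″ : Sub Γ Ξ} →
            (∀ {σ} (x : σ ∈ Γ) → subT θ′ (θ x) ≡ θ″ x) →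
            (t : Tm Γ τ) → subT θ′ (subT θ t) ≡ subT θ″ t
  sub-sub h (var x) = h x
  sub-sub h (con k) = refl
  sub-sub {θ = θ} h (ƛ t) =
    cong ƛ (sub-sub (λ { (here p) → refl ; (there x) → trans (↑-sub (θ x)) (cong _↑ (h x)) }) t)
  sub-sub h (t · u) = cong₂ _·_ (sub-sub h t) (sub-sub h u)

  sub-id : {θ : Sub Γ Γ} → (∀ {σ} (x : σ ∈ Γ) → θ x ≡ var x) → (t : Tm Γ τ) → subT θ t ≡ t
  sub-id h (var x) = h x
  sub-id h (con k) = refl
  sub-id h (ƛ t)   = cong ƛ (sub-id (λ { (here refl) → refl ; (there x) → cong _↑ (h x) }) t)
  sub-id h (t · u) = cong₂ _·_ (sub-id h t) (sub-id h u)

  ren-as-sub : {ρ : Ren Γ Δ} {θ : Sub Γ Δ} → (∀ {σ} (x : σ ∈ Γ) → var (ρ x) ≡ θ x) →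
               (t : Tm Γ τ) → renT ρ t ≡ subT θ t
  ren-as-sub h (var x) = h x
  ren-as-sub h (con k) = refl
  ren-as-sub h (ƛ t)   = cong ƛ (ren-as-sub (λ { (here p) → refl ; (there x) → cong _↑ (h x) }) t)
  ren-as-sub h (t · u) = cong₂ _·_ (ren-as-sub h t) (ren-as-sub h u)

  ↑-inst : (t : Tm Γ τ) {u : Tm Γ σ} → subT (w0 ▸ u) (t ↑) ≡ t
  ↑-inst t = trans (sub-ren (λ _ → refl) t) (sub-id (λ _ → refl) t)

  subF-subF : {θ : Sub Γ Δ} {θ′ : Sub Δ Ξ} {θ″ : Sub Γ Ξ} →
              (∀ {σ} (x : σ ∈ Γ) → subT θ′ (θ x) ≡ θ″ x) →
              (A : Fm Γ a) → subF θ′ (subF θ A) ≡ subF θ″ A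
  subF-subF h (t ≐ u) = cong₂ _≐_ (sub-sub h t) (sub-sub h u)
  subF-subF h ⊥̇       = refl
  subF-subF h (A ∧̇ B) = cong₂ _∧̇_ (subF-subF h A) (subF-subF h B)
  subF-subF h (A ∨̇ B) = cong₂ _∨̇_ (subF-subF h A) (subF-subF h B)
  subF-subF h (A ⊃ B) = cong₂ _⊃_ (subF-subF h A) (subF-subF h B)
  subF-subF {θ = θ} h (∀̇ A) =
    cong ∀̇ (subF-subF (λ { (here p) → refl ; (there x) → trans (↑-sub (θ x)) (cong _↑ (h x)) }) A)
  subF-subF {θ = θ} h (∃̇ A) =
    cong ∃̇ (subF-subF (λ { (here p) → refl ; (there x) → trans (↑-sub (θ x)) (cong _↑ (h x)) }) A)

  -- Turns weakening into substitution, so that `subF-subF` is the only composition law proved by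
  -- induction on formulas.
  renF-as-subF : {ρ : Ren Γ Δ} {θ : Sub Γ Δ} → (∀ {σ} (x : σ ∈ Γ) → var (ρ x) ≡ θ x) →
                 (A : Fm Γ a) → renF ρ A ≡ subF θ A
  renF-as-subF h (t ≐ u) = cong₂ _≐_ (ren-as-sub h t) (ren-as-sub h u)
  renF-as-subF h ⊥̇       = refl
  renF-as-subF h (A ∧̇ B) = cong₂ _∧̇_ (renF-as-subF h A) (renF-as-subF h B)
  renF-as-subF h (A ∨̇ B) = cong₂ _∨̇_ (renF-as-subF h A) (renF-as-subF h B)
  renF-as-subF h (A ⊃ B) = cong₂ _⊃_ (renF-as-subF h A) (renF-as-subF h B)
  renF-as-subF h (∀̇ A) =
    cong ∀̇ (renF-as-subF (λ { (here p) → refl ; (there x) → cong _↑ (h x) }) A)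
  renF-as-subF h (∃̇ A) =
    cong ∃̇ (renF-as-subF (λ { (here p) → refl ; (there x) → cong _↑ (h x) }) A)

  subF-renF : {ρ : Ren Γ Δ} {θ : Sub Δ Ξ} {θ′ : Sub Γ Ξ} →
              (∀ {σ} (x : σ ∈ Γ) → θ (ρ x) ≡ θ′ x) →
              (A : Fm Γ a) → subF θ (renF ρ A) ≡ subF θ′ A
  subF-renF {θ = θ} h A = trans (cong (subF θ) (renF-as-subF (λ _ → refl) A)) (subF-subF h A)

  ⇑-sub : {θ : Sub Γ Δ} (A : Fm Γ a) → subF (liftS {σ = σ} θ) (A ⇑) ≡ subF θ A ⇑
  ⇑-sub {θ = θ} A =
    trans (subF-renF (λ x → ren-as-sub (λ _ → refl) (θ x)) A)
      (sym (trans (renF-as-subF (λ _ → refl) (subF θ A)) (subF-subF (λ _ → refl) A)))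

  []-sub : {θ : Sub Γ Δ} (A : Fm (σ ∷ Γ) a) (t : Tm Γ σ) →
           subF θ (A [ t ]) ≡ (subF (liftS θ) A) [ subT θ t ]
  []-sub {θ = θ} A t =
    trans (subF-subF (λ _ → refl) A)
      (sym (subF-subF (λ { (here refl) → refl ; (there x) → ↑-inst (θ x) }) A))

  -- The recursion is on the shape: the existential case passes to `A [ con fst · t ]`, which is not
  -- a subterm of `∃̇ A` but has a smaller shape.
  mr-sub : (θ : Sub Γ Δ) (t : Tm Γ (tp a)) (A : Fm Γ a) →
           subF θ (t mr A) ≡ (subT θ t mr subF θ A)
  mr-sub {a = eq _}    θ t (r ≐ s) = refl
  mr-sub {a = bot}     θ t ⊥̇       = refl
  mr-sub {a = a and b} θ t (A ∧̇ B) =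
    cong₂ _∧̇_ (mr-sub θ (con fst · t) A) (mr-sub θ (con snd · t) B)
  mr-sub {a = a or b}  θ t (A ∨̇ B) =
    cong₂ (λ A′ B′ → (con fst · subT θ t ≐ con tt ⊃ A′) ∧̇ (con fst · subT θ t ≐ con ff ⊃ B′))
      (mr-sub θ (con fst · (con snd · t)) A) (mr-sub θ (con snd · (con snd · t)) B)
  mr-sub {a = a imp b} θ t (A ⊃ B) =
    cong₂ (λ A′ B′ → ∀̇ (A′ ⊃ B′))
      (trans (mr-sub (liftS θ) v0 (A ⇑)) (cong (v0 mr_) (⇑-sub A)))
      (trans (mr-sub (liftS θ) (t ↑ · v0) (B ⇑))
        (cong₂ (λ t′ B′ → t′ · v0 mr B′) (↑-sub t) (⇑-sub B)))
  mr-sub {a = all _ a} θ t (∀̇ A) =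
    cong ∀̇ (trans (mr-sub (liftS θ) (t ↑ · v0) A) (cong (λ t′ → t′ · v0 mr _) (↑-sub t)))
  mr-sub {a = ex _ a}  θ t (∃̇ A) =
    trans (mr-sub θ (con snd · t) (A [ con fst · t ])) (cong (_ mr_) ([]-sub A (con fst · t)))

  subF-id : {θ : Sub Γ Γ} → (∀ {σ} (x : σ ∈ Γ) → θ x ≡ var x) → (A : Fm Γ a) → subF θ A ≡ A
  subF-id h (t ≐ u) = cong₂ _≐_ (sub-id h t) (sub-id h u)
  subF-id h ⊥̇       = refl
  subF-id h (A ∧̇ B) = cong₂ _∧̇_ (subF-id h A) (subF-id h B)
  subF-id h (A ∨̇ B) = cong₂ _∨̇_ (subF-id h A) (subF-id h B)
  subF-id h (A ⊃ B) = cong₂ _⊃_ (subF-id h A) (subF-id h B)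
  subF-id h (∀̇ A)   = cong ∀̇ (subF-id (λ { (here refl) → refl ; (there x) → cong _↑ (h x) }) A)
  subF-id h (∃̇ A)   = cong ∃̇ (subF-id (λ { (here refl) → refl ; (there x) → cong _↑ (h x) }) A)

  ⇑-inst : (A : Fm (σ ∷ Γ) a) → renF (liftR there) A [ v0 ] ≡ A
  ⇑-inst A = trans (subF-renF (λ _ → refl) A)
               (subF-id (λ { (here refl) → refl ; (there x) → refl }) A)

-- Equality and normalisation

cast : ∀ {Γ a} {Δ : Hyps Γ} {A B : Fm Γ a} → A ≡ B → Δ ⊢ A → Δ ⊢ B
cast {Δ = Δ} = subst (Δ ⊢_)

module _ {Γ : Ctx} {Δ : Hyps Γ} where

  ≐-sym : ∀ {σ} {t u : Tm Γ σ} → Δ ⊢ t ≐ u → Δ ⊢ u ≐ t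
  ≐-sym {t = t} {u} p =
    cast (cong (u ≐_) (↑-inst t))
      (≐-subst (v0 ≐ t ↑) p (cast (cong (t ≐_) (sym (↑-inst t))) ≐-refl))

  ≐-trans : ∀ {σ} {t u v : Tm Γ σ} → Δ ⊢ t ≐ u → Δ ⊢ u ≐ v → Δ ⊢ t ≐ v
  ≐-trans {t = t} {u} {v} p q =
    cast (cong (_≐ v) (↑-inst t))
      (≐-subst (t ↑ ≐ v0) q (cast (cong (_≐ u) (sym (↑-inst t))) p))

  ≐-·ʳ : ∀ {σ τ} (f : Tm Γ (σ ⇒ τ)) {t u : Tm Γ σ} → Δ ⊢ t ≐ u → Δ ⊢ f · t ≐ f · u
  ≐-·ʳ f {t} {u} p =
    cast (cong₂ (λ f′ t′ → f′ · t′ ≐ f′ · u) (↑-inst f) (↑-inst t))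
      (≐-subst (f ↑ · t ↑ ≐ f ↑ · v0) p
        (cast (cong₂ (λ f′ t′ → f′ · t′ ≐ f′ · t) (sym (↑-inst f)) (sym (↑-inst t))) ≐-refl))

  ≐-·ˡ : ∀ {σ τ} {f g : Tm Γ (σ ⇒ τ)} (t : Tm Γ σ) → Δ ⊢ f ≐ g → Δ ⊢ f · t ≐ g · t
  ≐-·ˡ {f = f} {g} t p =
    cast (cong₂ (λ f′ t′ → f′ · t′ ≐ g · t′) (↑-inst f) (↑-inst t))
      (≐-subst (f ↑ · t ↑ ≐ v0 · t ↑) p
        (cast (cong₂ (λ f′ t′ → f′ · t′ ≐ f · t′) (sym (↑-inst f)) (sym (↑-inst t))) ≐-refl))

  ≐-· : ∀ {σ τ} {f g : Tm Γ (σ ⇒ τ)} {t u : Tm Γ σ} →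
        Δ ⊢ f ≐ g → Δ ⊢ t ≐ u → Δ ⊢ f · t ≐ g · u
  ≐-· {g = g} {t} p q = ≐-trans (≐-·ˡ t p) (≐-·ʳ g q)

-- The ξ-rule is not primitive. By extensionality it suffices to apply both abstractions to a fresh
-- variable and β-reduce.
≐-ƛ : ∀ {Γ σ τ} {Δ : Hyps Γ} {t u : Tm (σ ∷ Γ) τ} → wkHyps Δ ⊢ t ≐ u → Δ ⊢ ƛ t ≐ ƛ u
≐-ƛ {Δ = Δ} {t} {u} p =
  ≐-ext (∀I (≐-trans (β-weakened t) (≐-trans p (≐-sym (β-weakened u)))))
  where
  β-weakened : ∀ s → wkHyps Δ ⊢ ƛ s ↑ · v0 ≐ s
  β-weakened s =
    cast (cong (ƛ s ↑ · v0 ≐_)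
           (trans (sub-ren (λ _ → refl) s)
             (sub-id (λ { (here refl) → refl ; (there x) → refl }) s)))
      (β (renT (liftR there) s) v0)

-- The equation is demanded under all hypotheses because normalising below a binder uses it under
-- weakened ones.
Reduct : ∀ {Γ σ} → Tm Γ σ → Set
Reduct {Γ} {σ} t = Σ (Tm Γ σ) λ t′ → (Δ : Hyps Γ) → Δ ⊢ t ≐ t′

contract : ∀ {Γ σ τ} (f : Tm Γ (σ ⇒ τ)) (u : Tm Γ σ) → Maybe (Reduct (f · u))
contract (ƛ t) u                                    = just (-, λ _ → β t u)
contract (con rec · t · f) (con zero)               = just (-, λ _ → rec-zero t f)
contract (con rec · t · f) (con suc · n)            = just (-, λ _ → rec-suc t f n)
contract (con fold · t · f) (con nil)               = just (-, λ _ → fold-nil t f)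
contract (con fold · t · f) (con snoc · s · x)      = just (-, λ _ → fold-snoc t f s x)
contract f u                                        = nothing

-- The fuel k bounds the nesting of contractions; running out of it is sound.
mutual
  normalise : ∀ {Γ σ} (k : ℕ) (t : Tm Γ σ) → Reduct t
  normalise zero    t       = t , λ _ → ≐-refl
  normalise (suc k) (var x) = var x , λ _ → ≐-refl
  normalise (suc k) (con c) = con c , λ _ → ≐-refl
  normalise (suc k) (ƛ t)   =
    let t′ , p = normalise (suc k) t in ƛ t′ , λ _ → ≐-ƛ (p _)
  normalise (suc k) (t · u) =
    let t′ , p = normalise (suc k) t
        u′ , q = normalise (suc k) u
        v  , r = apply k t′ u′
    in v , λ Δ → ≐-trans (≐-· (p Δ) (q Δ)) (r Δ)

  apply : ∀ {Γ σ τ} (k : ℕ) (f : Tm Γ (σ ⇒ τ)) (u : Tm Γ σ) → Reduct (f · u)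
  apply k f u with contract f u
  ... | nothing      = f · u , λ _ → ≐-refl
  ... | just (v , p) = let v′ , q = normalise k v in v′ , λ Δ → ≐-trans (p Δ) (q Δ)

nf : ∀ {Γ σ} (t : Tm Γ σ) → Reduct t
-- Any bound works that lets the `refl` arguments of `conv` and `≐-conv` check.
nf = normalise 100

-- Schematic formulas

-- Everything about A and R is confined to the atoms 𝐀 x k and 𝐑 r, for M(k,x)
-- and N(r), so that substitution into a schematic formula computes even
-- though M and N are arbitrary.
module Schematic {Γ₀ : Ctx} {σ ρ : Ty} {m n : Shape}
                 (M : Fm (σ ∷ nat ∷ Γ₀) m) (N : Fm (ρ ∷ Γ₀) n) where

  infix  7 _≐ˢ_
  infixr 6 _∧ˢ_
  infixr 4 _⊃ˢ_

  data Sch (Θ : Ctx) : Shape → Set where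
    _≐ˢ_ : ∀ {τ} → Tm (Θ ++ Γ₀) τ → Tm (Θ ++ Γ₀) τ → Sch Θ (eq τ)
    _∧ˢ_ : ∀ {a b} → Sch Θ a → Sch Θ b → Sch Θ (a and b)
    _⊃ˢ_ : ∀ {a b} → Sch Θ a → Sch Θ b → Sch Θ (a imp b)
    ∀ˢ   : ∀ {τ a} → Sch (τ ∷ Θ) a → Sch Θ (all τ a)
    ∃ˢ   : ∀ {τ a} → Sch (τ ∷ Θ) a → Sch Θ (ex τ a)
    𝐀    : Tm (Θ ++ Γ₀) σ → Tm (Θ ++ Γ₀) nat → Sch Θ m
    𝐑    : Tm (Θ ++ Γ₀) ρ → Sch Θ n

  base : ∀ Θ → Ren Γ₀ (Θ ++ Γ₀)
  base []      x = x
  base (_ ∷ Θ) x = there (base Θ x)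

  ⟦_⟧ : ∀ {Θ a} → Sch Θ a → Fm (Θ ++ Γ₀) a
  ⟦ t ≐ˢ u ⟧ = t ≐ u
  ⟦ A ∧ˢ B ⟧ = ⟦ A ⟧ ∧̇ ⟦ B ⟧
  ⟦ A ⊃ˢ B ⟧ = ⟦ A ⟧ ⊃ ⟦ B ⟧
  ⟦ ∀ˢ A ⟧   = ∀̇ ⟦ A ⟧
  ⟦ ∃ˢ A ⟧   = ∃̇ ⟦ A ⟧
  ⟦_⟧ {Θ} (𝐀 x k) = subF ((var ∘ base Θ) ▸ k ▸ x) M
  ⟦_⟧ {Θ} (𝐑 r)   = subF ((var ∘ base Θ) ▸ r) N

  subS : ∀ {Θ Θ′ a} → Sub (Θ ++ Γ₀) (Θ′ ++ Γ₀) → Sch Θ a → Sch Θ′ a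
  subS θ (t ≐ˢ u) = subT θ t ≐ˢ subT θ u
  subS θ (A ∧ˢ B) = subS θ A ∧ˢ subS θ B
  subS θ (A ⊃ˢ B) = subS θ A ⊃ˢ subS θ B
  subS θ (∀ˢ A)   = ∀ˢ (subS (liftS θ) A)
  subS θ (∃ˢ A)   = ∃ˢ (subS (liftS θ) A)
  subS θ (𝐀 x k)  = 𝐀 (subT θ x) (subT θ k)
  subS θ (𝐑 r)    = 𝐑 (subT θ r)

  -- `θ` has to fix `Γ₀`, whose variables may occur in `M` and `N`; it then acts on an atom through
  -- its arguments alone.
  ⟦subS⟧ : ∀ {Θ Θ′ a} {θ : Sub (Θ ++ Γ₀) (Θ′ ++ Γ₀)} →
           (∀ {τ} (x : τ ∈ Γ₀) → θ (base Θ x) ≡ var (base Θ′ x)) →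
           (A : Sch Θ a) → ⟦ subS θ A ⟧ ≡ subF θ ⟦ A ⟧
  ⟦subS⟧ h (t ≐ˢ u) = refl
  ⟦subS⟧ h (A ∧ˢ B) = cong₂ _∧̇_ (⟦subS⟧ h A) (⟦subS⟧ h B)
  ⟦subS⟧ h (A ⊃ˢ B) = cong₂ _⊃_ (⟦subS⟧ h A) (⟦subS⟧ h B)
  ⟦subS⟧ h (∀ˢ A)   = cong ∀̇ (⟦subS⟧ (λ x → cong _↑ (h x)) A)
  ⟦subS⟧ h (∃ˢ A)   = cong ∃̇ (⟦subS⟧ (λ x → cong _↑ (h x)) A)
  ⟦subS⟧ h (𝐀 x k)  =
    sym (subF-subF (λ { (here refl) → refl ; (there (here refl)) → refl ; (there (there y)) → h y }) M)
  ⟦subS⟧ h (𝐑 r)    = sym (subF-subF (λ { (here refl) → refl ; (there y) → h y }) N)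

  infix 10 _[_]ˢ
  _[_]ˢ : ∀ {Θ τ a} → Sch (τ ∷ Θ) a → Tm (Θ ++ Γ₀) τ → Sch Θ a
  A [ t ]ˢ = subS (w0 ▸ t) A

  ⟦[]⟧ : ∀ {Θ τ a} (A : Sch (τ ∷ Θ) a) {t : Tm (Θ ++ Γ₀) τ} → ⟦ A [ t ]ˢ ⟧ ≡ ⟦ A ⟧ [ t ]
  ⟦[]⟧ A = ⟦subS⟧ (λ _ → refl) A

  HypsS : Ctx → Set
  HypsS Θ = List (∃ (Sch Θ))

  ⟦_⟧* : ∀ {Θ} → HypsS Θ → Hyps (Θ ++ Γ₀)
  ⟦_⟧* = map λ (_ , A) → -, ⟦ A ⟧

  wkS : ∀ {Θ τ} → HypsS Θ → HypsS (τ ∷ Θ)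
  wkS = map λ (_ , A) → -, subS w1 A

  ⟦wkS⟧ : ∀ {Θ τ} (Δ : HypsS Θ) → ⟦ wkS {τ = τ} Δ ⟧* ≡ wkHyps ⟦ Δ ⟧*
  ⟦wkS⟧ []            = refl
  ⟦wkS⟧ ((_ , A) ∷ Δ) = cong₂ (λ B Δ′ → (-, B) ∷ Δ′) ⟦wk⟧ (⟦wkS⟧ Δ)
    where ⟦wk⟧ = trans (⟦subS⟧ (λ _ → refl) A) (sym (renF-as-subF (λ _ → refl) ⟦ A ⟧))

  infix 2 _⊩_
  record _⊩_ {Θ} (Δ : HypsS Θ) {a} (A : Sch Θ a) : Set where
    constructor ⟨_⟩
    field derivation : ⟦ Δ ⟧* ⊢ ⟦ A ⟧
  open _⊩_ public

  module _ {Θ : Ctx} {Δ : HypsS Θ} where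

    hyp# : ∀ k {k< : True (k <? length Δ)} → Δ ⊩ proj₂ (lookup Δ (#_ k {m<n = k<}))
    hyp# k {k<} = ⟨ hyp (∈-map⁺ _ (∈-lookup (#_ k {m<n = k<}))) ⟩

    ⊃Iˢ : ∀ {a b} {A : Sch Θ a} {B : Sch Θ b} → (-, A) ∷ Δ ⊩ B → Δ ⊩ A ⊃ˢ B
    ⊃Iˢ ⟨ d ⟩ = ⟨ ⊃I d ⟩

    ⊃Eˢ : ∀ {a b} {A : Sch Θ a} {B : Sch Θ b} → Δ ⊩ A ⊃ˢ B → Δ ⊩ A → Δ ⊩ B
    ⊃Eˢ ⟨ d ⟩ ⟨ e ⟩ = ⟨ ⊃E d e ⟩

    ∧Iˢ : ∀ {a b} {A : Sch Θ a} {B : Sch Θ b} → Δ ⊩ A → Δ ⊩ B → Δ ⊩ A ∧ˢ B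
    ∧Iˢ ⟨ d ⟩ ⟨ e ⟩ = ⟨ ∧I d e ⟩

    ∧E₁ˢ : ∀ {a b} {A : Sch Θ a} {B : Sch Θ b} → Δ ⊩ A ∧ˢ B → Δ ⊩ A
    ∧E₁ˢ ⟨ d ⟩ = ⟨ ∧E₁ d ⟩

    ∧E₂ˢ : ∀ {a b} {A : Sch Θ a} {B : Sch Θ b} → Δ ⊩ A ∧ˢ B → Δ ⊩ B
    ∧E₂ˢ ⟨ d ⟩ = ⟨ ∧E₂ d ⟩

    ∀Iˢ : ∀ {τ a} {A : Sch (τ ∷ Θ) a} → wkS Δ ⊩ A → Δ ⊩ ∀ˢ A
    ∀Iˢ {A = A} ⟨ d ⟩ = ⟨ ∀I (subst (_⊢ ⟦ A ⟧) (⟦wkS⟧ Δ) d) ⟩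

    ∀Eˢ : ∀ {τ a} {A : Sch (τ ∷ Θ) a} → Δ ⊩ ∀ˢ A → (t : Tm (Θ ++ Γ₀) τ) → Δ ⊩ A [ t ]ˢ
    ∀Eˢ {A = A} ⟨ d ⟩ t = ⟨ cast (sym (⟦[]⟧ A)) (∀E d t) ⟩

    ∃Iˢ : ∀ {τ a} {A : Sch (τ ∷ Θ) a} (t : Tm (Θ ++ Γ₀) τ) → Δ ⊩ A [ t ]ˢ → Δ ⊩ ∃ˢ A
    ∃Iˢ {A = A} t ⟨ d ⟩ = ⟨ ∃I t (cast (⟦[]⟧ A) d) ⟩

    ∃Eˢ : ∀ {τ a c} {A : Sch (τ ∷ Θ) a} {C : Sch Θ c} →
          Δ ⊩ ∃ˢ A → (-, A) ∷ wkS Δ ⊩ subS w1 C → Δ ⊩ C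
    ∃Eˢ {A = A} {C} ⟨ d ⟩ ⟨ e ⟩ =
      ⟨ ∃E d (cast (trans (⟦subS⟧ (λ _ → refl) C) (sym (renF-as-subF (λ _ → refl) ⟦ C ⟧)))
               (subst (_⊢ ⟦ subS w1 C ⟧) (cong ((-, ⟦ A ⟧) ∷_) (⟦wkS⟧ Δ)) e)) ⟩

    ≐-substˢ : ∀ {τ a} (A : Sch (τ ∷ Θ) a) {t u : Tm (Θ ++ Γ₀) τ} →
               Δ ⊩ t ≐ˢ u → Δ ⊩ A [ t ]ˢ → Δ ⊩ A [ u ]ˢ
    ≐-substˢ A ⟨ p ⟩ ⟨ d ⟩ = ⟨ cast (sym (⟦[]⟧ A)) (≐-subst ⟦ A ⟧ p (cast (⟦[]⟧ A) d)) ⟩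

    nat-indˢ : ∀ {a} (A : Sch (nat ∷ Θ) a) →
               Δ ⊩ A [ con zero ]ˢ → Δ ⊩ ∀ˢ (A ⊃ˢ subS (w1 ▸ con suc · v0) A) → Δ ⊩ ∀ˢ A
    nat-indˢ A ⟨ d ⟩ ⟨ e ⟩ =
      ⟨ nat-ind ⟦ A ⟧ (cast (⟦[]⟧ A) d)
          (cast (cong (λ B → ∀̇ (⟦ A ⟧ ⊃ B)) (⟦subS⟧ (λ _ → refl) A)) e) ⟩

    seq-indˢ : ∀ {τ a} (A : Sch (τ ⋆ ∷ Θ) a) →
               Δ ⊩ A [ con nil ]ˢ →
               Δ ⊩ ∀ˢ (A ⊃ˢ ∀ˢ (subS (w2 ▸ con snoc · v1 · v0) A)) →
               Δ ⊩ ∀ˢ A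
    seq-indˢ A ⟨ d ⟩ ⟨ e ⟩ =
      ⟨ seq-ind ⟦ A ⟧ (cast (⟦[]⟧ A) d)
          (cast (cong (λ B → ∀̇ (⟦ A ⟧ ⊃ ∀̇ B)) (⟦subS⟧ (λ _ → refl) A)) e) ⟩

    biˢ : ∀ {τ s p} (S : Sch (τ ⋆ ∷ Θ) s) (P : Sch (τ ⋆ ∷ Θ) p) →
          Δ ⊩ S [ con nil ]ˢ →
          Δ ⊩ ∀ˢ {τ = nat ⇒ τ}
                (  ∀ˢ {τ = nat} (subS (w2 ▸ init v1 v0) S)
                ⊃ˢ ∃ˢ {τ = nat} (subS (w2 ▸ init v1 v0) P)) →
          Δ ⊩ ∀ˢ {τ = τ ⋆}
                (  S
                ⊃ˢ ∀ˢ {τ = τ} (  subS (w2 ▸ con snoc · v1 · v0) S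
                               ⊃ˢ subS (w2 ▸ con snoc · v1 · v0) P)
                ⊃ˢ P) →
          Δ ⊩ P [ con nil ]ˢ
    biˢ S P ⟨ start ⟩ ⟨ bar ⟩ ⟨ step ⟩ =
      ⟨ cast (sym (⟦[]⟧ P))
          (⊃E (⊃E (⊃E (bi ⟦ S ⟧ ⟦ P ⟧)
            (cast (⟦[]⟧ S) start))
            (cast (cong₂ (λ S′ P′ → ∀̇ (∀̇ S′ ⊃ ∃̇ P′))
                    (⟦subS⟧ (λ _ → refl) S) (⟦subS⟧ (λ _ → refl) P)) bar))
            (cast (cong₂ (λ S′ P′ → ∀̇ (⟦ S ⟧ ⊃ ∀̇ (S′ ⊃ P′) ⊃ ⟦ P ⟧))
                    (⟦subS⟧ (λ _ → refl) S) (⟦subS⟧ (λ _ → refl) P)) step)) ⟩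

  -- Normal forms of schematic formulas

  Convertible : ∀ {Γ a} → Fm Γ a → Fm Γ a → Set
  Convertible A B = ∀ Δ → (Δ ⊢ A ⊃ B) × (Δ ⊢ B ⊃ A)

  -- `η` is the common pattern of `θ` and `θ′`, with a fresh variable where they have `t` and `u`.
  -- This rewrites inside `M` and `N`, which cannot be analysed further.
  replace : ∀ {Γ Ξ a} {θ θ′ : Sub Ξ Γ} (A : Fm Ξ a) {τ} {t u : Tm Γ τ} (η : Sub Ξ (τ ∷ Γ)) →
            (∀ {υ} (x : υ ∈ Ξ) → subT (w0 ▸ t) (η x) ≡ θ x) →
            (∀ {υ} (x : υ ∈ Ξ) → subT (w0 ▸ u) (η x) ≡ θ′ x) →
            (∀ Δ → Δ ⊢ t ≐ u) → Convertible (subF θ A) (subF θ′ A)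
  replace A η ht hu p Δ =
      ⊃I (cast (subF-subF hu A) (≐-subst (subF η A) (p _)
           (cast (sym (subF-subF ht A)) (hyp (here refl)))))
    , ⊃I (cast (subF-subF ht A) (≐-subst (subF η A) (≐-sym (p _))
           (cast (sym (subF-subF hu A)) (hyp (here refl)))))

  convertible-trans : ∀ {Γ a} {A B C : Fm Γ a} → Convertible A B → Convertible B C → Convertible A C
  convertible-trans p q Δ =
      ⊃I (⊃E (proj₁ (q _)) (⊃E (proj₁ (p _)) (hyp (here refl))))
    , ⊃I (⊃E (proj₂ (p _)) (⊃E (proj₂ (q _)) (hyp (here refl))))

  nfS : ∀ {Θ a} (A : Sch Θ a) → Σ (Sch Θ a) λ A′ → Convertible ⟦ A ⟧ ⟦ A′ ⟧
  nfS (t ≐ˢ u) =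
    let t′ , p = nf t ; u′ , q = nf u in
    t′ ≐ˢ u′ , λ Δ →
        ⊃I (≐-trans (≐-sym (p _)) (≐-trans (hyp (here refl)) (q _)))
      , ⊃I (≐-trans (p _) (≐-trans (hyp (here refl)) (≐-sym (q _))))
  nfS (A ∧ˢ B) =
    let A′ , p = nfS A ; B′ , q = nfS B in
    A′ ∧ˢ B′ , λ Δ →
        ⊃I (∧I (⊃E (proj₁ (p _)) (∧E₁ (hyp (here refl)))) (⊃E (proj₁ (q _)) (∧E₂ (hyp (here refl)))))
      , ⊃I (∧I (⊃E (proj₂ (p _)) (∧E₁ (hyp (here refl)))) (⊃E (proj₂ (q _)) (∧E₂ (hyp (here refl)))))
  nfS (A ⊃ˢ B) =
    let A′ , p = nfS A ; B′ , q = nfS B in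
    (A′ ⊃ˢ B′) , λ Δ →
        ⊃I (⊃I (⊃E (proj₁ (q _)) (⊃E (hyp (there (here refl))) (⊃E (proj₂ (p _)) (hyp (here refl))))))
      , ⊃I (⊃I (⊃E (proj₂ (q _)) (⊃E (hyp (there (here refl))) (⊃E (proj₁ (p _)) (hyp (here refl))))))
  nfS (∀ˢ A) =
    let A′ , p = nfS A in
    ∀ˢ A′ , λ Δ →
        ⊃I (∀I (⊃E (proj₁ (p _)) (cast (⇑-inst ⟦ A ⟧) (∀E (hyp (here refl)) v0))))
      , ⊃I (∀I (⊃E (proj₂ (p _)) (cast (⇑-inst ⟦ A′ ⟧) (∀E (hyp (here refl)) v0))))
  nfS (∃ˢ A) =
    let A′ , p = nfS A in
    ∃ˢ A′ , λ Δ →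
        ⊃I (∃E (hyp (here refl)) (∃I v0 (cast (sym (⇑-inst ⟦ A′ ⟧)) (⊃E (proj₁ (p _)) (hyp (here refl))))))
      , ⊃I (∃E (hyp (here refl)) (∃I v0 (cast (sym (⇑-inst ⟦ A ⟧)) (⊃E (proj₂ (p _)) (hyp (here refl))))))
  nfS {Θ} (𝐀 x k) =
    let x′ , p = nf x ; k′ , q = nf k in
    𝐀 x′ k′ , convertible-trans
      (replace {θ′ = (var ∘ base Θ) ▸ k ▸ x′} M ((var ∘ there ∘ base Θ) ▸ k ↑ ▸ v0)
        (λ { (here refl) → refl ; (there (here refl)) → ↑-inst k ; (there (there _)) → refl })
        (λ { (here refl) → refl ; (there (here refl)) → ↑-inst k ; (there (there _)) → refl }) p)
      (replace M ((var ∘ there ∘ base Θ) ▸ v0 ▸ x′ ↑)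
        (λ { (here refl) → ↑-inst x′ ; (there (here refl)) → refl ; (there (there _)) → refl })
        (λ { (here refl) → ↑-inst x′ ; (there (here refl)) → refl ; (there (there _)) → refl }) q)
  nfS {Θ} (𝐑 r) =
    let r′ , p = nf r in
    𝐑 r′ , replace N ((var ∘ there ∘ base Θ) ▸ v0)
      (λ { (here refl) → refl ; (there _) → refl })
      (λ { (here refl) → refl ; (there _) → refl }) p

  module _ {Θ : Ctx} {Δ : HypsS Θ} where

    -- Leaves all computation with `cons`, `init`, `ext` and `shift` to a comparison of normal
    -- forms.
    conv : ∀ {a} {A B : Sch Θ a} → Δ ⊩ A → proj₁ (nfS A) ≡ proj₁ (nfS B) → Δ ⊩ B
    conv {A = A} {B} ⟨ d ⟩ e =
      ⟨ ⊃E (proj₂ (proj₂ (nfS B) _))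
          (subst (λ C → ⟦ Δ ⟧* ⊢ ⟦ C ⟧) e (⊃E (proj₁ (proj₂ (nfS A) _)) d)) ⟩

    ≐-conv : ∀ {τ} {t u : Tm (Θ ++ Γ₀) τ} → proj₁ (nf t) ≡ proj₁ (nf u) → Δ ⊩ t ≐ˢ u
    ≐-conv {t = t} {u} e =
      ⟨ ≐-trans (cast (cong (t ≐_) e) (proj₂ (nf t) _)) (≐-sym (proj₂ (nf u) _)) ⟩

    ≐-symˢ : ∀ {τ} {t u : Tm (Θ ++ Γ₀) τ} → Δ ⊩ t ≐ˢ u → Δ ⊩ u ≐ˢ t
    ≐-symˢ ⟨ p ⟩ = ⟨ ≐-sym p ⟩

    ≐-transˢ : ∀ {τ} {t u v : Tm (Θ ++ Γ₀) τ} → Δ ⊩ t ≐ˢ u → Δ ⊩ u ≐ˢ v → Δ ⊩ t ≐ˢ v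
    ≐-transˢ ⟨ p ⟩ ⟨ q ⟩ = ⟨ ≐-trans p q ⟩

    ≐-·ˢ : ∀ {τ υ} {f g : Tm (Θ ++ Γ₀) (τ ⇒ υ)} {t u : Tm (Θ ++ Γ₀) τ} →
           Δ ⊩ f ≐ˢ g → Δ ⊩ t ≐ˢ u → Δ ⊩ f · t ≐ˢ g · u
    ≐-·ˢ ⟨ p ⟩ ⟨ q ⟩ = ⟨ ≐-· p q ⟩

    ≐-reflˢ : ∀ {τ} {t : Tm (Θ ++ Γ₀) τ} → Δ ⊩ t ≐ˢ t
    ≐-reflˢ = ⟨ ≐-refl ⟩

    ≐-extˢ : ∀ {τ υ} {f g : Tm (Θ ++ Γ₀) (τ ⇒ υ)} →
             Δ ⊩ ∀ˢ (f ↑ · v0 ≐ˢ g ↑ · v0) → Δ ⊩ f ≐ˢ g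
    ≐-extˢ ⟨ p ⟩ = ⟨ ≐-ext p ⟩

    suc-injˢ : {k l : Tm (Θ ++ Γ₀) nat} → Δ ⊩ con suc · k ≐ˢ con suc · l → Δ ⊩ k ≐ˢ l
    suc-injˢ ⟨ p ⟩ = ⟨ suc-inj p ⟩

    zero≠sucˢ : ∀ {a} {A : Sch Θ a} {k : Tm (Θ ++ Γ₀) nat} →
                Δ ⊩ con zero ≐ˢ con suc · k → Δ ⊩ A
    zero≠sucˢ ⟨ p ⟩ = ⟨ ⊥E (zero≠suc p) ⟩

    -- Derivations are not shown closed under weakening; a lemma cut in as a
    -- hypothesis is weakened by ∀Iˢ and ∃Eˢ instead.
    haveˢ : ∀ {a c} {A : Sch Θ a} {C : Sch Θ c} → Δ ⊩ A → (-, A) ∷ Δ ⊩ C → Δ ⊩ C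
    haveˢ d e = ⊃Eˢ (⊃Iˢ e) d

  -- Bar induction

  v3 : ∀ {Γ τ τ₀ τ₁ τ₂} → Tm (τ₀ ∷ τ₁ ∷ τ₂ ∷ τ ∷ Γ) τ
  v3 = v2 ↑
  v4 : ∀ {Γ τ τ₀ τ₁ τ₂ τ₃} → Tm (τ₀ ∷ τ₁ ∷ τ₂ ∷ τ₃ ∷ τ ∷ Γ) τ
  v4 = v3 ↑
  v5 : ∀ {Γ τ τ₀ τ₁ τ₂ τ₃ τ₄} → Tm (τ₀ ∷ τ₁ ∷ τ₂ ∷ τ₃ ∷ τ₄ ∷ τ ∷ Γ) τ
  v5 = v4 ↑
  v6 : ∀ {Γ τ τ₀ τ₁ τ₂ τ₃ τ₄ τ₅} → Tm (τ₀ ∷ τ₁ ∷ τ₂ ∷ τ₃ ∷ τ₄ ∷ τ₅ ∷ τ ∷ Γ) τ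
  v6 = v5 ↑

  Seq : Ty
  Seq = nat ⇒ σ

  𝐬 : ∀ {Γ} → Tm Γ nat → Tm Γ nat
  𝐬 k = con suc · k

  -- ext s α is the concatenation s * α, and shift s i is |s| + i.
  ext : ∀ {Γ} → Tm Γ (σ ⋆) → Tm Γ Seq → Tm Γ Seq
  ext s α = con fold · ƛ v0 · ƛ (ƛ (ƛ (ƛ (v1 · cons v2 v0)))) · s · α

  shift : ∀ {Γ} → Tm Γ (σ ⋆) → Tm Γ nat → Tm Γ nat
  shift s i = con fold · ƛ v0 · ƛ (ƛ (ƛ (ƛ (v1 · (con suc · v0))))) · s · i

  len : ∀ {Γ} → Tm Γ (σ ⋆) → Tm Γ nat
  len s = shift s (con zero)

  _∗_ : ∀ {Γ} → Tm Γ (σ ⋆) → Tm Γ σ → Tm Γ (σ ⋆)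
  s ∗ x = con snoc · s · x

  private variable
    Θ : Ctx
    Δ : HypsS Θ

  -- Lengths, concatenation and initial segments

  shift-suc : Δ ⊩ ∀ˢ {τ = σ ⋆} (∀ˢ {τ = nat} (shift v1 (𝐬 v0) ≐ˢ 𝐬 (shift v1 v0)))
  shift-suc = seq-indˢ _ (∀Iˢ (≐-conv refl))
    (∀Iˢ (⊃Iˢ (∀Iˢ (∀Iˢ (conv (∀Eˢ (hyp# 0) (𝐬 v0)) refl)))))

  -- The folds unfold (s * x) * α to s * (x * α) and |s * x| + i to |s| + (i + 1), so the inductive
  -- hypothesis is taken at x * α and i + 1.
  ext-shift : Δ ⊩ ∀ˢ {τ = σ ⋆} (∀ˢ {τ = Seq} (∀ˢ {τ = nat} (ext v2 v1 · shift v2 v0 ≐ˢ v1 · v0)))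
  ext-shift = seq-indˢ _ (∀Iˢ (∀Iˢ (≐-conv refl)))
    (∀Iˢ (⊃Iˢ (∀Iˢ (∀Iˢ (∀Iˢ
      (conv (∀Eˢ (∀Eˢ (hyp# 0) (cons v2 v1)) (𝐬 v0)) refl))))))

  init-ext : Δ ⊩ ∀ˢ {τ = σ ⋆} (∀ˢ {τ = Seq} (init (ext v1 v0) (len v1) ≐ˢ v1))
  init-ext = seq-indˢ _ (∀Iˢ (≐-conv refl))
    (∀Iˢ (⊃Iˢ (∀Iˢ (∀Iˢ
      (conv {A = init (ext v2 (cons v1 v0)) (shift v2 (𝐬 (con zero))) ≐ˢ v2 ∗ v1}
        -- With its index in the form `𝐬 (len s)`, `init` unfolds to [s * (x * α)](|s|) followed by
        -- entry |s|, which is x.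
        (≐-substˢ (init (ext v3 (cons v2 v1)) v0 ≐ˢ v3 ∗ v2)
          (≐-symˢ (∀Eˢ (∀Eˢ shift-suc v2) (con zero)))
          (≐-transˢ {u = init (ext v2 (cons v1 v0)) (len v2) ∗ (ext v2 (cons v1 v0) · len v2)}
            (≐-conv refl)
            (≐-·ˢ (≐-·ˢ ≐-reflˢ (∀Eˢ (hyp# 0) (cons v1 v0)))
              (conv (∀Eˢ (∀Eˢ (∀Eˢ ext-shift v2) (cons v1 v0)) (con zero)) refl))))
        refl)))))

  len-init : Δ ⊩ ∀ˢ {τ = Seq} (∀ˢ {τ = nat} (len (init v1 v0) ≐ˢ v0))
  len-init = ∀Iˢ (nat-indˢ _ (≐-conv refl)
    (∀Iˢ (⊃Iˢ (conv {A = shift (init v1 v0) (𝐬 (con zero)) ≐ˢ 𝐬 v0}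
      (≐-transˢ (∀Eˢ (∀Eˢ shift-suc (init v1 v0)) (con zero))
        (≐-·ˢ ≐-reflˢ (hyp# 0)))
      refl))))

  -- Unfolding ips along a finite sequence

  tail : ∀ {Γ} → Tm Γ (Seq ⇒ ρ) → Tm Γ (σ ⋆) → Tm Γ (Seq ⇒ ρ)
  tail q s = ƛ (q ↑ · ext (s ↑) v0)

  -- This is ips_|s|(ε)(q_s), with `tail q s` for q_s; `choice` is its head c.
  run : ∀ {Γ} → Tm Γ (ipsTy σ ρ) → Tm Γ (nat ⇒ Jᵗ ρ σ) → Tm Γ (Seq ⇒ ρ) → Tm Γ (σ ⋆) → Tm Γ Seq
  run ips ε q s = ips · len s · ε · tail q s

  choice : ∀ {Γ} → Tm Γ (ipsTy σ ρ) → Tm Γ (nat ⇒ Jᵗ ρ σ) → Tm Γ (Seq ⇒ ρ) → Tm Γ (σ ⋆) → Tm Γ σ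
  choice ips ε q s =
    ε · len s · ƛ (after (tail q s ↑) v0 · ((ips · 𝐬 (len s) · ε) ↑ · after (tail q s ↑) v0))

  -- Interpreted by `⟦_⟧`, this computes to `ipsEq v0`.
  ips-eq : Sch (ipsTy σ ρ ∷ []) _
  ips-eq =
    ∀ˢ {τ = nat} (∀ˢ {τ = nat ⇒ Jᵗ ρ σ} (∀ˢ {τ = Seq ⇒ ρ}
      (v3 · v2 · v1 · v0 ≐ˢ cons c (v3 · 𝐬 v2 · v1 · after v0 c))))
    where
    c = v1 · v2 · ƛ (after (v0 ↑) v0 · ((v3 · 𝐬 v2 · v1) ↑ · after (v0 ↑) v0))

  ε-realizes : Sch ((nat ⇒ Jᵗ ρ σ) ∷ ipsTy σ ρ ∷ []) _
  ε-realizes =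
    ∀ˢ {τ = nat} (∀ˢ {τ = σ ⇒ ρ}
      (∀ˢ {τ = σ} (𝐀 v0 v2 ⊃ˢ 𝐑 (v1 · v0)) ⊃ˢ 𝐀 (v2 · v1 · v0) v1))

  -- v0, v1, v2 are q, ε, ips.
  Context : Ctx
  Context = (Seq ⇒ ρ) ∷ (nat ⇒ Jᵗ ρ σ) ∷ ipsTy σ ρ ∷ []

  q-realizes : Sch Context _
  q-realizes = ∀ˢ {τ = Seq} (∀ˢ {τ = nat} (𝐀 (v1 · v0) v0) ⊃ˢ 𝐑 (v1 · v0))

  Assumptions : HypsS Context
  Assumptions = (-, q-realizes) ∷ wkS ((-, ε-realizes) ∷ wkS ((-, ips-eq) ∷ []))

  run-zero : Sch Context _
  run-zero = ∀ˢ {τ = σ ⋆} (run v3 v2 v1 v0 · con zero ≐ˢ choice v3 v2 v1 v0)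

  run-suc : Sch Context _
  run-suc = ∀ˢ {τ = σ ⋆} (∀ˢ {τ = nat}
    (run v4 v3 v2 v1 · 𝐬 v0 ≐ˢ run v4 v3 v2 (v1 ∗ choice v4 v3 v2 v1) · v0))

  -- Common to the bar and the step, which differ in how they show that the argument of ε_|s|
  -- realizes A(|s|) → R.
  head-realizes : Sch Context _
  head-realizes = ∀ˢ {τ = σ ⋆}
    (∀ˢ {τ = σ} (𝐀 v0 (len v1) ⊃ˢ 𝐑 (v2 · ext v1 (cons v0 (run v4 v3 v2 (v1 ∗ v0)))))
      ⊃ˢ 𝐀 (run v3 v2 v1 v0 · con zero) (len v0))

  constant-tail : Sch Context _
  constant-tail = ∀ˢ {τ = ρ} (𝐑 v0 ⊃ˢ ∀ˢ {τ = nat} (∀ˢ {τ = σ ⋆}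
    (∀ˢ {τ = Seq} (v4 · ext v1 v0 ≐ˢ v3) ⊃ˢ 𝐀 (run v5 v4 v3 v0 · v1) (shift v0 v1))))

  run-zero-holds : (-, run-suc) ∷ Assumptions ⊩ run-zero
  run-zero-holds = ∀Iˢ
    (conv (≐-·ˢ (∀Eˢ (∀Eˢ (∀Eˢ (hyp# 3) (len v0)) v2) (tail v1 v0))
                (≐-reflˢ {t = con zero}))
      refl)

  -- The defining equation gives the tail ips_{|s|+1}(ε)((q_s)_c). Here (q_s)_c and q_{s*c} have the
  -- same normal form, and `shift-suc` identifies |s| + 1 with |s * c|.
  run-suc-holds : Assumptions ⊩ run-suc
  run-suc-holds = ∀Iˢ (∀Iˢ
    (≐-substˢ (run v5 v4 v3 v2 · 𝐬 v1 ≐ˢ v5 · v0 · v4 · tail v3 (v2 ∗ choice v5 v4 v3 v2) · v1)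
      (≐-symˢ (conv {B = shift (v1 ∗ choice v4 v3 v2 v1) (con zero) ≐ˢ 𝐬 (len v1)}
        (∀Eˢ (∀Eˢ shift-suc v1) (con zero)) refl))
      (conv (≐-·ˢ (∀Eˢ (∀Eˢ (∀Eˢ (hyp# 2) (len v1)) v3) (tail v2 v1))
                  (≐-reflˢ {t = 𝐬 v0}))
        refl)))

  head-realizes-holds : (-, run-zero) ∷ (-, run-suc) ∷ Assumptions ⊩ head-realizes
  head-realizes-holds = ∀Iˢ (⊃Iˢ
    (≐-substˢ (𝐀 v0 (len v1)) (≐-symˢ (∀Eˢ (hyp# 1) v0))
      (⊃Eˢ (∀Eˢ (∀Eˢ (hyp# 4) (len v0)) p)
        (∀Iˢ (⊃Iˢ
          (conv
            -- The hypothesis runs ips at `len (s ∗ x)`, whereas the argument of ε_|s| calls it at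
            -- `𝐬 (len s)`.
            (≐-substˢ (𝐑 (v3 · ext v2 (cons v1 (v5 · v0 · v4 · tail v3 (v2 ∗ v1)))))
              (conv {B = shift (v1 ∗ v0) (con zero) ≐ˢ 𝐬 (len v1)}
                (∀Eˢ (∀Eˢ shift-suc v1) (con zero)) refl)
              (⊃Eˢ (∀Eˢ (hyp# 1) v0) (hyp# 0)))
            refl))))))
    where
    p = ƛ (after (tail v1 v0 ↑) v0 · ((v3 · 𝐬 (len v0) · v2) ↑ · after (tail v1 v0 ↑) v0))

  -- Induction on the position i, for all s at once: entry i + 1 of the run at s is entry i of the
  -- run at s * c, and q_{s*c} is constant with the same value. Entry 0 is `head-realizes`.
  constant-tail-holds :
    (-, head-realizes) ∷ (-, run-zero) ∷ (-, run-suc) ∷ Assumptions ⊩ constant-tail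
  constant-tail-holds = ∀Iˢ (⊃Iˢ (nat-indˢ _
    (∀Iˢ (⊃Iˢ (⊃Eˢ (∀Eˢ (hyp# 2) v0)
      (∀Iˢ (⊃Iˢ
        (≐-substˢ (𝐑 v0)
          (≐-symˢ (∀Eˢ (hyp# 1) (cons v0 (run v5 v4 v3 (v1 ∗ v0)))))
          (hyp# 2)))))))
    (∀Iˢ (⊃Iˢ (∀Iˢ (⊃Iˢ
      (≐-substˢ (𝐀 v0 (shift v1 (𝐬 v2)))
        (≐-symˢ (∀Eˢ (∀Eˢ (hyp# 5) v0) v1))
        (conv
          (⊃Eˢ (∀Eˢ (hyp# 1) (v0 ∗ choice v5 v4 v3 v0))
            (∀Iˢ (conv (∀Eˢ (hyp# 0) (cons (choice v6 v5 v4 v1) v0)) refl)))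
          refl))))))))

  -- Premises of the bar induction

  Lemmas : HypsS Context
  Lemmas =
    (-, constant-tail) ∷ (-, head-realizes) ∷ (-, run-zero) ∷ (-, run-suc) ∷ Assumptions

  -- Only the last entry of s is asserted to realize A: bar induction uses 𝐒 on
  -- all initial segments at once.
  𝐒 : Sch (σ ⋆ ∷ Context) _
  𝐒 =  ∀ˢ {τ = Seq} (∀ˢ {τ = nat} (𝐀 (v1 · v0) (shift v2 v0)) ⊃ˢ 𝐑 (v2 · ext v1 v0))
    ∧ˢ ∀ˢ {τ = Seq} (∀ˢ {τ = nat} (len v2 ≐ˢ 𝐬 v0 ⊃ˢ 𝐀 (ext v2 v1 · v0) v0))

  𝐏 : Sch (σ ⋆ ∷ Context) _
  𝐏 = ∀ˢ {τ = nat} (𝐀 (run v4 v3 v2 v1 · v0) (shift v1 v0))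

  𝐒-nil : Lemmas ⊩ 𝐒 [ con nil ]ˢ
  𝐒-nil = ∧Iˢ
    (∀Iˢ (⊃Iˢ (conv
      (⊃Eˢ (∀Eˢ (hyp# 5) v0)
        (conv (hyp# 0) refl))
      refl)))
    (∀Iˢ (∀Iˢ (⊃Iˢ (zero≠sucˢ {k = v0} (conv (hyp# 0) refl)))))

  -- For the first conjunct, that of `𝐒` at s is used with x * α, distinguishing index 0 from
  -- successors. For the second, |s * x| = k + 1 forces k = |s|, and entry |s| of s * x * α is x.
  𝐒-snoc : ∀ {Δ} → Δ ⊩ ∀ˢ (𝐒 ⊃ˢ ∀ˢ {τ = σ} (𝐀 v0 (len v1) ⊃ˢ subS (w2 ▸ v1 ∗ v0) 𝐒))
  𝐒-snoc = ∀Iˢ (⊃Iˢ (∀Iˢ (⊃Iˢ (∧Iˢ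
    (∀Iˢ (⊃Iˢ (conv
      (⊃Eˢ (∀Eˢ (∧E₁ˢ (hyp# 2)) (cons v1 v0))
        (nat-indˢ _ (conv (hyp# 1) refl)
          (∀Iˢ (⊃Iˢ (conv (∀Eˢ (hyp# 1) v0) refl)))))
      refl)))
    (∀Iˢ (∀Iˢ (⊃Iˢ
      (≐-substˢ (𝐀 (ext (v4 ∗ v3) v2 · v0) v0)
        (suc-injˢ (≐-transˢ (≐-symˢ (∀Eˢ (∀Eˢ shift-suc v3) (con zero)))
          (conv (hyp# 0) refl)))
        (conv
          (≐-substˢ (𝐀 v0 (len v4))
            (≐-symˢ (∀Eˢ (∀Eˢ (∀Eˢ ext-shift v3) (cons v2 v1)) (con zero)))
            (conv (hyp# 1) refl))
          refl)))))))))

  bar-step : Lemmas ⊩ ∀ˢ (  𝐒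
                         ⊃ˢ ∀ˢ {τ = σ} (subS (w2 ▸ v1 ∗ v0) 𝐒 ⊃ˢ subS (w2 ▸ v1 ∗ v0) 𝐏)
                         ⊃ˢ 𝐏)
  bar-step = haveˢ 𝐒-snoc (∀Iˢ (⊃Iˢ (⊃Iˢ
    -- The head: if x realizes A(|s|), then `𝐒` and hence `𝐏` hold at s * x, and the first conjunct
    -- of `𝐒` there is applied to the run at s * x.
    (haveˢ {A = 𝐀 (run v3 v2 v1 v0 · con zero) (len v0)}
      (⊃Eˢ (∀Eˢ (hyp# 4) v0)
        (∀Iˢ (⊃Iˢ
          (haveˢ (⊃Eˢ (∀Eˢ (⊃Eˢ (∀Eˢ (hyp# 3) v1) (hyp# 2)) v0)
                   (hyp# 0))
            (conv
              (⊃Eˢ (∀Eˢ (∧E₁ˢ (hyp# 0)) (run v4 v3 v2 (v1 ∗ v0)))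
                (⊃Eˢ (∀Eˢ (hyp# 2) v0) (hyp# 0)))
              refl)))))
    -- The tail: by `run-zero` the choice c is the head just treated, so `𝐒` holds at s * c and the
    -- premise of the step gives `𝐏` there.
    (haveˢ
      (⊃Eˢ (∀Eˢ (⊃Eˢ (∀Eˢ (hyp# 3) v0) (hyp# 2)) (choice v3 v2 v1 v0))
        (≐-substˢ (𝐀 v0 (len v1)) (∀Eˢ (hyp# 6) v0) (hyp# 0)))
    (nat-indˢ _ (hyp# 1)
      (∀Iˢ (⊃Iˢ
        (≐-substˢ (𝐀 v0 (shift v2 (𝐬 v1)))
          (≐-symˢ (∀Eˢ (∀Eˢ (hyp# 9) v1) v0))
          (conv
            (∀Eˢ (⊃Eˢ (∀Eˢ (hyp# 3) (choice v4 v3 v2 v1)) (hyp# 1)) v0)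
            refl))))))))))

  contˢ : ∀ {Θ} {Δ : HypsS Θ} → Discrete ρ → Δ ⊩
    ∀ˢ {τ = Seq ⇒ ρ} (∀ˢ {τ = Seq} (∃ˢ {τ = nat} (∀ˢ {τ = Seq}
      (init v2 v1 ≐ˢ init v0 v1 ⊃ˢ v3 · v2 ≐ˢ v3 · v0))))
  contˢ discrete = ⟨ cont discrete ⟩

  bar : Discrete ρ → Lemmas ⊩ ∀ˢ {τ = Seq}
          (  ∀ˢ {τ = nat} (subS (w2 ▸ init v1 v0) 𝐒)
          ⊃ˢ ∃ˢ {τ = nat} (subS (w2 ▸ init v1 v0) 𝐏))
  bar discrete = ∀Iˢ (⊃Iˢ
    (haveˢ {A = ∀ˢ (𝐀 (v1 · v0) v0)}
      -- The second conjunct of `𝐒` at [α](n+1) concerns entry n of [α](n+1) * α. This sequence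
      -- unfolds to [α](n) * (α(n) * α), and [α](n) has length n.
      (∀Iˢ (≐-substˢ (𝐀 v0 v1)
        (≐-transˢ {u = ext (init v1 v0) (cons (v1 · v0) v1) · len (init v1 v0)}
          (≐-·ˢ ≐-reflˢ (≐-symˢ (∀Eˢ (∀Eˢ len-init v1) v0)))
          (conv {B = _ ≐ˢ v1 · v0}
            (∀Eˢ (∀Eˢ (∀Eˢ ext-shift (init v1 v0)) (cons (v1 · v0) v1)) (con zero)) refl))
        (conv
          (⊃Eˢ (∀Eˢ (∀Eˢ (∧E₂ˢ (∀Eˢ (hyp# 0) (𝐬 v0))) v1) v0)
            (∀Eˢ (∀Eˢ len-init v1) (𝐬 v0)))
          refl)))
    (haveˢ {A = 𝐑 (v1 · v0)} (⊃Eˢ (∀Eˢ (hyp# 6) v0) (hyp# 0))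
    (∃Eˢ (∀Eˢ (∀Eˢ (contˢ discrete) v1) v0)
      (∃Iˢ v0 (∀Iˢ
        -- The n from CONT is where the bar is met: every [α](n) * β agrees with α up to n, so
        -- q_{[α](n)} is constant with value q(α).
        (⊃Eˢ (∀Eˢ (∀Eˢ (⊃Eˢ (∀Eˢ (hyp# 4) (v3 · v2)) (hyp# 1)) v0) (init v2 v1))
          (∀Iˢ (≐-symˢ (⊃Eˢ (∀Eˢ (hyp# 0) (ext (init v3 v2) v0))
            -- `init-ext` cuts at the length of [α](n), which `len-init` rewrites to n.
            (≐-symˢ (≐-substˢ (init (ext (init v4 v3) v1) v0 ≐ˢ init v4 v3)
              (∀Eˢ (∀Eˢ len-init v3) v2)
              (∀Eˢ (∀Eˢ init-ext (init v3 v2)) v0)))))))))))))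

  ips-realizes-shift : Discrete ρ → (-, ips-eq) ∷ [] ⊩
    ∀ˢ (ε-realizes ⊃ˢ ∀ˢ (q-realizes ⊃ˢ ∀ˢ (𝐀 (v3 · con zero · v2 · v1 · v0) v0)))
  ips-realizes-shift discrete = ∀Iˢ (⊃Iˢ (∀Iˢ (⊃Iˢ
    (haveˢ run-suc-holds (haveˢ run-zero-holds (haveˢ head-realizes-holds
    (haveˢ constant-tail-holds
    (haveˢ (biˢ 𝐒 𝐏 𝐒-nil (bar discrete) bar-step)
      (∀Iˢ
        (≐-substˢ (𝐀 (v4 · con zero · v3 · v0 · v1) v1)
          -- The run at ⟨⟩ uses λα. q(α). Normalisation has no η-rule, so extensionality identifies
          -- this with q.
          (≐-extˢ {f = ƛ (v2 · v0)} (∀Iˢ (≐-conv refl)))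
          (conv (∀Eˢ (hyp# 0) v0) refl)))))))))))

-- Realizers of the J-shift

infixr 5 _▹_

-- Unfolding `mr` weakens A and R repeatedly. A chain of `▹` ending in `self` lists these renamings
-- and collapses them into one substitution.
_▹_ : ∀ {Γ Δ Ξ a} {A : Fm Γ a} {B : Fm Δ a} {θ : Sub Γ Δ} (ϱ : Ren Δ Ξ) →
      B ≡ subF θ A → renF ϱ B ≡ subF (renT ϱ ∘ θ) A
_▹_ {A = A} {θ = θ} ϱ refl =
  trans (renF-as-subF (λ _ → refl) (subF θ A))
    (subF-subF (λ x → sym (ren-as-sub (λ _ → refl) (θ x))) A)

self : ∀ {Γ a} (A : Fm Γ a) → A ≡ subF w0 A
self A = sym (subF-id (λ _ → refl) A)

-- The atoms `𝐀` and `𝐑` are instances of `v0 mr A ⇑` and `v0 mr R ⇑`; `η` supplies the realizer for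
-- `v0` and acts as `θ` on the formula.
mr-instance : ∀ {Γ Γ′ a} {θ : Sub Γ Γ′} {η : Sub (tp a ∷ Γ) Γ′} (A : Fm Γ a) {B : Fm Γ′ a} →
              B ≡ subF θ A → (∀ {τ} (x : τ ∈ Γ) → η (there x) ≡ θ x) →
              subF η (v0 mr A ⇑) ≡ (η (here refl) mr B)
mr-instance {η = η} A refl h =
  trans (mr-sub η v0 (A ⇑)) (cong (_ mr_) (subF-renF h A))

-- Discreteness of an implication requires compactness of its antecedent and conversely, so both are
-- proved together. Quantifier-free realizer types are built from `bool` alone; `nat` enters only
-- through the existential witness.
Σ⁰₁-discrete : ∀ {r} → Σ⁰₁ r → Discrete (tp r)
Σ⁰₁-discrete (ex-nat R) = nat ⊗ discrete R
  where
  compact  : ∀ {a} → QuantifierFree a → Compact (tp a)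
  discrete : ∀ {a} → QuantifierFree a → Discrete (tp a)
  compact eq-bool    = bool
  compact eq-nat     = bool
  compact bot        = bool
  compact (A and B)  = compact A ⊗ compact B
  compact (A or B)   = bool ⊗ compact A ⊗ compact B
  compact (A imp B)  = discrete A ⇒ compact B
  discrete eq-bool   = bool
  discrete eq-nat    = bool
  discrete bot       = bool
  discrete (A and B) = discrete A ⊗ discrete B
  discrete (A or B)  = bool ⊗ discrete A ⊗ discrete B
  discrete (A imp B) = compact A ⇒ discrete B

J-shift-realizer : ∀ {Γ a r} (A : Fm (nat ∷ Γ) a) (R : Fm Γ r) →
  let open Schematic (v0 mr A ⇑) (v0 mr R ⇑) in
  ⟦ ∀ˢ (ε-realizes ⊃ˢ ∀ˢ (q-realizes ⊃ˢ ∀ˢ (𝐀 (v3 · con zero · v2 · v1 · v0) v0))) ⟧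
    ≡ (v0 · con zero mr (J-shift A R) ⇑)
J-shift-realizer A R =
  cong₂ (λ B C → ∀̇ (B ⊃ C))
    (cong ∀̇ (cong ∀̇ (cong₂ _⊃_
      (cong ∀̇ (cong₂ _⊃_
        (mr-instance A
          (there ▹ there ▹ liftR there ▹ liftR there ▹ self A)
          (λ { (here refl) → refl ; (there _) → refl }))
        (mr-instance R
          (there ▹ there ▹ liftR there ▹ liftR there ▹ there ▹ self R)
          (λ _ → refl))))
      (mr-instance A
        (there ▹ liftR there ▹ liftR there ▹ self A)
        (λ { (here refl) → refl ; (there _) → refl })))))
    (cong ∀̇ (cong₂ _⊃_
      (cong ∀̇ (cong₂ _⊃_
        (cong ∀̇ (mr-instance A
          (liftR there ▹ liftR there ▹ liftR there ▹ liftR there ▹ self A)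
          (λ { (here refl) → refl ; (there _) → refl })))
        (mr-instance R
          (there ▹ there ▹ there ▹ there ▹ self R)
          (λ _ → refl))))
      (cong ∀̇ (mr-instance A
        (liftR there ▹ liftR there ▹ liftR there ▹ self A)
        (λ { (here refl) → refl ; (there _) → refl })))))

theorem4p3 : ∀ {Γ a r} (A : Fm (nat ∷ Γ) a) (R : Fm Γ r) → Σ⁰₁ r →
    (-, ipsEq {ipsTy (tp a) (tp r) ∷ Γ} v0) ∷ [] ⊢ (v0 · con zero mr (J-shift A R) ⇑)
theorem4p3 A R Σ-R =
  cast (J-shift-realizer A R) (derivation (ips-realizes-shift (Σ⁰₁-discrete Σ-R)))
  where open Schematic (v0 mr A ⇑) (v0 mr R ⇑)
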